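{- Let $n\ge 1$ be an integer, let $q$ be a prime power, let $\mathcal{C}\subseteq \mathrm{U}(n,\mathbb{F}_q)$ be a (not necessarily linear) flag-rank-metric code with minimum distance $\delta$, and let $t=\left\lfloor\frac{\delta-1}{2}\right\rfloor$. Then \[ |\mathcal{C}|\, b_q(n,t)\le q^{\frac{n(n+1)}{2}}. \]
   Context: $\mathbb{F}_q$ is the finite field with $q$ elements. $\mathrm{U}(n,\mathbb{F}_q)$ is the $\mathbb{F}_q$-vector space of $n\times n$ upper triangular matrices over $\mathbb{F}_q$. For $M\in \mathrm{U}(n,\mathbb{F}_q)$ and $1\le i\le n$, $M_{[i]}$ is the $i\times(n-i+1)$ submatrix of $M$ obtained by deleting the first $i-1$ columns and the last $n-i$ rows (i.e. rows $1,\dots,i$ and columns $i,\dots,n$). The flag-rank weight of $M$ is $\mathrm{fr}(M)=\sum_{i=1}^{n}\mathrm{rk}(M_{[i]})$; the flag-rank distance $\mathrm{d}_{\mathrm{fr}}(A,B)=\mathrm{fr}(A-B)$ is a metric on $\mathrm{U}(n,\mathbb{F}_q)$. A (not necessarily linear) flag-rank-metric code is a subset $\mathcal{C}\subseteq \mathrm{U}(n,\mathbb{F}_q)$; its minimum distance, defined when $|\mathcal{C}|\ge 2$, is $\delta=\min\{\mathrm{d}_{\mathrm{fr}}(A,B):A,B\in\mathcal{C},\ A\ne B\}$ (so "with minimum distance $\delta$" entails $|\mathcal{C}|\ge 2$). The number $b_q(n,t)=|\{A\in \mathrm{U}(n,\mathbb{F}_q):\mathrm{fr}(A)\le t\}|$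 is the size of a flag-rank ball of radius $t$. -}

module Defs where

open import Algebra.Apartness.Bundles using (HeytingField)
open import Algebra.Bundles using (CommutativeRing)
import Algebra.Properties.CommutativeMonoid.Sum as Sum
import Algebra.Properties.Ring as RingProperties
open import Data.Fin.Base as Fin
  using (Fin; zero; suc; toℕ; inject≤; cast; _↑ʳ_; funToFin; finToFun)
import Data.Fin.Properties as Fin
open import Data.Nat.Base as ℕ using (ℕ; zero; suc; _≤_; _∸_; _^_)
open import Data.Nat.Primality using (Prime)
import Data.Nat.Properties as ℕ
open import Data.Product.Base using (Σ-syntax; ∃; ∃-syntax; ∃₂; _×_; _,_; proj₁; proj₂)
import Data.Vec.Functional.Relation.Binary.Equality.Setoid as VecEq
open import Function.Base using (_∘_)
open import Function.Bundles using (Inverse)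
import Function.Construct.Composition as Compose
open import Function.Properties.Inverse using (Inverse⇒Injection)
open import Level using (Level; _⊔_)
open import Relation.Binary.Bundles using (Setoid)
open import Relation.Binary.Definitions using (Decidable; _Respects_)
import Relation.Binary.Construct.On as On
open import Relation.Binary.PropositionalEquality as ≡ using (_≡_; _≗_; refl)
open import Relation.Nullary.Decidable using (Dec; yes; no; map′; _→-dec_)
open import Relation.Nullary.Negation using (¬_; contradiction)
import Relation.Unary as U
open import Relation.Unary using (Pred)

private
  variable
    a c ℓ ℓ₁ ℓ₂ p p′ : Level

IsPrimePower : ℕ → Set
IsPrimePower q = ∃₂ λ p k → Prime p × 1 ≤ k × q ≡ p ^ k

-- The largest k ≤ n satisfying P, and 0 if there is none.
greatest : {P : Pred ℕ p} → U.Decidable P → ℕ → ℕ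
greatest P? zero    = zero
greatest P? (suc n) with P? (suc n)
... | yes _ = suc n
... | no  _ = greatest P? n

greatest-cong : {P : Pred ℕ p} {Q : Pred ℕ p′}
                (P? : U.Decidable P) (Q? : U.Decidable Q) →
                (∀ k → P k → Q k) → (∀ k → Q k → P k) →
                ∀ n → greatest P? n ≡ greatest Q? n
greatest-cong P? Q? P⇒Q Q⇒P zero = refl
greatest-cong P? Q? P⇒Q Q⇒P (suc n) with P? (suc n) | Q? (suc n)
... | yes _ | yes _ = refl
... | yes p | no ¬q = contradiction (P⇒Q _ p) ¬q
... | no ¬p | yes q = contradiction (Q⇒P _ q) ¬p
... | no _  | no _  = greatest-cong P? Q? P⇒Q Q⇒P n

------------------------------------------------------------------------
-- Cardinality of setoids

-- Elements are counted up to the setoid equality.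
HasSize : Setoid a ℓ → ℕ → Set (a ⊔ ℓ)
HasSize S k = Inverse S (≡.setoid (Fin k))

subset : (S : Setoid a ℓ) → Pred (Setoid.Carrier S) p → Setoid (a ⊔ p) ℓ
subset S P = On.setoid S (proj₁ {B = P})

Fin-size : ∀ n → HasSize (≡.setoid (Fin n)) n
Fin-size n = record
  { to = λ i → i ; from = λ i → i
  ; to-cong = λ eq → eq ; from-cong = λ eq → eq
  ; inverse = (λ eq → eq) , (λ eq → eq) }

vector-size : {S : Setoid a ℓ} {k : ℕ} → HasSize S k →
              ∀ n → HasSize (VecEq.≋-setoid S n) (k ^ n)
vector-size {S = S} {k} S≅ n = record
  { to        = λ v → funToFin (to ∘ v)
  ; from      = λ i → from ∘ finToFun i
  ; to-cong   = λ v≋w → funToFin-cong (λ i → to-cong (v≋w i))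
  ; from-cong = λ { refl _ → S.refl }
  ; inverse   =
      (λ {j} v≋ → ≡.trans
        (funToFin-cong (λ i → inverseˡ (v≋ i)))
        (Fin.funToFin-finToFin {n} j))
    , (λ { {v} refl i → inverseʳ (Fin.finToFun-funToFin (to ∘ v) i) })
  }
  where
  module S = Setoid S
  open Inverse S≅
  funToFin-cong : ∀ {m} {f g : Fin m → Fin k} → f ≗ g → funToFin f ≡ funToFin g
  funToFin-cong {zero}  f≗g = refl
  funToFin-cong {suc m} f≗g =
    ≡.cong₂ Fin.combine (f≗g zero) (funToFin-cong (f≗g ∘ suc))

private
  Fin-subset-size : ∀ {k} {P : Pred (Fin k) p} → U.Decidable P →
                    ∃[ m ] HasSize (subset (≡.setoid (Fin k)) P) m
  Fin-subset-size {k = zero} P? = 0 , record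
    { to = λ () ; from = λ () ; to-cong = λ { {()} } ; from-cong = λ { {()} }
    ; inverse = (λ { {()} }) , (λ { {()} }) }
  Fin-subset-size {k = suc k} {P} P? with Fin-subset-size (P? ∘ suc) | P? zero
  ... | m , I | yes p₀ = suc m , record
    { to        = to′
    ; from      = from′
    ; to-cong   = λ {x} {y} → to′-cong {x} {y}
    ; from-cong = λ { refl → refl }
    ; inverse   = (λ {i} {x} → invˡ {i} {x}) , (λ { {x} refl → invʳ {x} })
    }
    where
    open Inverse I
    to′ : ∃ P → Fin (suc m)
    to′ (zero  , _) = zero
    to′ (suc i , p) = suc (to (i , p))
    from′ : Fin (suc m) → ∃ P
    from′ zero    = zero , p₀
    from′ (suc j) = suc (proj₁ (from j)) , proj₂ (from j)
    to′-cong : ∀ {x y} → proj₁ x ≡ proj₁ y → to′ x ≡ to′ y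
    to′-cong {zero  , _} {zero  , _} refl = refl
    to′-cong {suc i , _} {suc i , _} refl = ≡.cong suc (to-cong refl)
    invˡ : ∀ {i x} → proj₁ x ≡ proj₁ (from′ i) → to′ x ≡ i
    invˡ {zero}  {zero  , _} refl = refl
    invˡ {suc i} {suc _ , _} eq   = ≡.cong suc (inverseˡ (Fin.suc-injective eq))
    invʳ : ∀ {x} → proj₁ (from′ (to′ x)) ≡ proj₁ x
    invʳ {zero  , _} = refl
    invʳ {suc i , _} = ≡.cong suc (inverseʳ refl)
  ... | m , I | no ¬p₀ = m , record
    { to        = to′
    ; from      = λ j → suc (proj₁ (from j)) , proj₂ (from j)
    ; to-cong   = λ {x} {y} → to′-cong {x} {y}
    ; from-cong = λ { refl → refl }
    ; inverse   = (λ {i} {x} → invˡ {i} {x}) , (λ { {x} refl → invʳ {x} })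
    }
    where
    open Inverse I
    to′ : ∃ P → Fin m
    to′ (zero  , p) = contradiction p ¬p₀
    to′ (suc i , p) = to (i , p)
    to′-cong : ∀ {x y} → proj₁ x ≡ proj₁ y → to′ x ≡ to′ y
    to′-cong {zero  , p} {zero  , _} refl = contradiction p ¬p₀
    to′-cong {suc i , _} {suc i , _} refl = to-cong refl
    invˡ : ∀ {i x} → proj₁ x ≡ suc (proj₁ (from i)) → to′ x ≡ i
    invˡ {i} {suc _ , _} eq = inverseˡ (Fin.suc-injective eq)
    invʳ : ∀ {x} → suc (proj₁ (from (to′ x))) ≡ proj₁ x
    invʳ {zero  , p} = contradiction p ¬p₀
    invʳ {suc i , _} = ≡.cong suc (inverseʳ refl)

subset-size : {S : Setoid a ℓ} {k : ℕ} → HasSize S k →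
              {P : Pred (Setoid.Carrier S) p} →
              U.Decidable P → P Respects (Setoid._≈_ S) →
              ∃[ m ] HasSize (subset S P) m
subset-size {S = S} S≅ {P} P? resp = m , Compose.inverse
  (record
    { to        = λ (x , px) → to x , resp (S.sym (inverseʳ refl)) px
    ; from      = λ (i , q) → from i , q
    ; to-cong   = to-cong
    ; from-cong = from-cong
    ; inverse   = inverseˡ , inverseʳ
    })
  I
  where
  module S = Setoid S
  open Inverse S≅
  m = proj₁ (Fin-subset-size (P? ∘ from))
  I = proj₂ (Fin-subset-size (P? ∘ from))

module _ {S : Setoid a ℓ} {k : ℕ} (S≅ : HasSize S k)
         {P : Pred (Setoid.Carrier S) p}
         (P? : U.Decidable P) (resp : P Respects (Setoid._≈_ S)) where

  open Inverse S≅

  all? : Dec (∀ x → P x)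
  all? = map′ (λ h x → resp (inverseʳ refl) (h (to x))) (λ h i → h (from i))
              (Fin.all? (P? ∘ from))

  any? : Dec (∃ P)
  any? = map′ (λ (i , h) → from i , h)
              (λ (x , h) → to x , resp (Setoid.sym S (inverseʳ refl)) h)
              (Fin.any? (P? ∘ from))

------------------------------------------------------------------------
-- Finite fields

-- On a finite carrier the apartness of a Heyting field is decidable and
-- coincides with inequality, so this is an ordinary field (with 0 ≉ 1).
record FiniteField c ℓ₁ ℓ₂ (q : ℕ) : Set (Level.suc (c ⊔ ℓ₁ ⊔ ℓ₂)) where
  field
    heytingField : HeytingField c ℓ₁ ℓ₂

  open HeytingField heytingField public using (heytingCommutativeRing)

  commutativeRing : CommutativeRing c ℓ₁
  commutativeRing = record
    { isCommutativeRing = HeytingField.isCommutativeRing heytingField }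

  open CommutativeRing commutativeRing public

  field
    size : HasSize setoid q

  infix 4 _≈?_
  _≈?_ : Decidable _≈_
  _≈?_ = Fin.inj⇒≟ (Inverse⇒Injection size)

module FlagRank {q : ℕ} (𝔽 : FiniteField c ℓ₁ ℓ₂ q) where

  private
    module 𝔽 = FiniteField 𝔽
    module Σ𝔽 = Sum 𝔽.+-commutativeMonoid
    module Σℕ = Sum ℕ.+-0-commutativeMonoid
    variable
      m n k : ℕ

  open 𝔽 using (_≈_; 0#)
  open Σ𝔽 using (sum-syntax)

  Vect : ℕ → Setoid c ℓ₁
  Vect = VecEq.≋-setoid 𝔽.setoid

  Matrices : ℕ → ℕ → Setoid c ℓ₁
  Matrices m n = VecEq.≋-setoid (Vect n) m

  Vector : ℕ → Set c
  Vector n = Setoid.Carrier (Vect n)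

  Matrix : ℕ → ℕ → Set c
  Matrix m n = Setoid.Carrier (Matrices m n)

  ----------------------------------------------------------------------
  -- Rank

  LinearlyIndependent : (Fin k → Vector m) → Set (c ⊔ ℓ₁)
  LinearlyIndependent {k} v = ∀ (x : Vector k) →
    (∀ i → ∑[ j < k ] (x j 𝔽.* v j i) ≈ 0#) → ∀ j → x j ≈ 0#

  column : Matrix m n → Fin n → Vector m
  column M j i = M i j

  -- A linearly independent family has no repetitions, so f is
  -- necessarily injective.
  HasIndependentColumns : Matrix m n → ℕ → Set (c ⊔ ℓ₁)
  HasIndependentColumns {n = n} M k =
    Σ[ f ∈ (Fin k → Fin n) ] LinearlyIndependent (λ j → column M (f j))

  linearlyIndependent? : (v : Fin k → Vector m) → Dec (LinearlyIndependent v)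
  linearlyIndependent? {k} v = all? (vector-size 𝔽.size k)
    (λ x → Fin.all? (λ i → _ 𝔽.≈? 0#) →-dec Fin.all? (λ j → x j 𝔽.≈? 0#))
    (λ {x} {y} x≋y h y-rel j → 𝔽.trans (𝔽.sym (x≋y j))
      (h (λ i → 𝔽.trans
        (Σ𝔽.sum-cong-≋ (λ j → 𝔽.*-congʳ (x≋y j))) (y-rel i)) j))

  linearlyIndependent-cong : {v w : Fin k → Vector m} →
    (∀ j i → v j i ≈ w j i) → LinearlyIndependent v → LinearlyIndependent w
  linearlyIndependent-cong v≋w h x rel = h x λ i →
    𝔽.trans (Σ𝔽.sum-cong-≋ (λ j → 𝔽.*-congˡ (v≋w j i))) (rel i)

  hasIndependentColumns? : (M : Matrix m n) →
                           U.Decidable (HasIndependentColumns M)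
  hasIndependentColumns? {n = n} M k = any? (vector-size (Fin-size n) k)
    (λ f → linearlyIndependent? (λ j → column M (f j)))
    (λ f≗g → linearlyIndependent-cong
      (λ j i → 𝔽.reflexive (≡.cong (M i) (f≗g j))))

  -- The largest size of a linearly independent family of columns.
  rank : Matrix m n → ℕ
  rank {n = n} M = greatest (hasIndependentColumns? M) n

  rank-cong : {M N : Matrix m n} → (∀ i j → M i j ≈ N i j) → rank M ≡ rank N
  rank-cong {n = n} {M} {N} M≋N = greatest-cong
    (hasIndependentColumns? M) (hasIndependentColumns? N)
    (λ _ (f , h) → f , linearlyIndependent-cong (λ j i → M≋N i (f j)) h)
    (λ _ (f , h) → f , linearlyIndependent-cong (λ j i → 𝔽.sym (M≋N i (f j))) h)
    n

  ----------------------------------------------------------------------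
  -- Upper triangular matrices and the flag-rank metric

  IsUpperTriangular : Pred (Matrix n n) ℓ₁
  IsUpperTriangular M = ∀ i j → j Fin.< i → M i j ≈ 0#

  UpperTriangular : ℕ → Setoid (c ⊔ ℓ₁) ℓ₁
  UpperTriangular n = subset (Matrices n n) IsUpperTriangular

  U : ℕ → Set (c ⊔ ℓ₁)
  U n = Setoid.Carrier (UpperTriangular n)

  infix 4 _≈ᵁ_
  _≈ᵁ_ : U n → U n → Set ℓ₁
  _≈ᵁ_ {n} = Setoid._≈_ (UpperTriangular n)

  infixl 6 _-_
  _-_ : U n → U n → U n
  (A , A-upper) - (B , B-upper) =
    (λ i j → A i j 𝔽.- B i j) ,
    (λ i j j<i → 𝔽.trans
      (𝔽.+-cong (A-upper i j j<i) (𝔽.-‿cong (B-upper i j j<i)))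
      (𝔽.-‿inverseʳ 0#))

  -- Here i is zero-based: the 1-based index is 1 + toℕ i, so the block has
  -- rows 0, …, toℕ i and columns toℕ i, …, n - 1 of M.
  _[_] : Matrix n n → (i : Fin n) → Matrix (suc (toℕ i)) (n ∸ toℕ i)
  (M [ i ]) r s =
    M (inject≤ r (Fin.toℕ<n i))
      (cast (ℕ.m+[n∸m]≡n (Fin.toℕ≤n i)) (toℕ i ↑ʳ s))

  fr : U n → ℕ
  fr {n} (M , _) = Σℕ.sum {n} (λ i → rank (M [ i ]))

  d-fr : U n → U n → ℕ
  d-fr A B = fr (A - B)

  fr-cong : {A B : U n} → A ≈ᵁ B → fr A ≡ fr B
  fr-cong {n} {A} {B} A≈B = Σℕ.sum-cong-≗ {n} (λ i →
    rank-cong {M = proj₁ A [ i ]} {N = proj₁ B [ i ]} (λ r s → A≈B _ _))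

  ----------------------------------------------------------------------
  -- Balls

  Ball : (n t : ℕ) → Pred (U n) _
  Ball n t A = fr A ≤ t

  UpperTriangular-size : ∀ n → ∃[ k ] HasSize (UpperTriangular n) k
  UpperTriangular-size n = subset-size
    (vector-size (vector-size 𝔽.size n) n)
    (λ M → Fin.all? (λ i → Fin.all? (λ j → (j Fin.<? i) →-dec (M i j 𝔽.≈? 0#))))
    (λ M≋N h i j j<i → 𝔽.trans (𝔽.sym (M≋N i j)) (h i j j<i))

  Ball-size : ∀ n t → ∃[ k ] HasSize (subset (UpperTriangular n) (Ball n t)) k
  Ball-size n t = subset-size (proj₂ (UpperTriangular-size n))
    (λ A → fr A ℕ.≤? t)
    (λ {A} {B} A≈B → ≡.subst (_≤ t) (fr-cong {A = A} {B} A≈B))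

  b : (n t : ℕ) → ℕ
  b n t = proj₁ (Ball-size n t)

  ----------------------------------------------------------------------
  -- Codes

  record Code (n : ℕ) ℓ : Set (c ⊔ ℓ₁ ⊔ Level.suc ℓ) where
    field
      member   : Pred (U n) ℓ
      respects : member Respects _≈ᵁ_

      -- Every subset of a finite set is classically finite; constructively
      -- its number of elements is part of the data.
      card     : ℕ
      hasCard  : HasSize (subset (UpperTriangular n) member) card

  open Code public using () renaming (card to ∣_∣)

  infix 4 _∈_
  _∈_ : U n → Code n ℓ → Set ℓ
  A ∈ C = Code.member C A

  HasMinimumDistance : Code n ℓ → ℕ → Set _
  HasMinimumDistance C δ =
    (∃₂ λ A B → A ∈ C × B ∈ C × ¬ (A ≈ᵁ B) × d-fr A B ≡ δ) ×
    (∀ A B → A ∈ C → B ∈ C → ¬ (A ≈ᵁ B) → δ ≤ d-fr A B)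

{-# OPTIONS --safe #-}

-- Sphere packing: (A , X) ↦ A − X is injective on 𝒞 × Ball t.  Indeed
-- A − X = B − Y gives A − B = X − Y, so d(A , B) = fr (X − Y) ≤ fr X + fr Y
-- ≤ 2 t < δ by subadditivity of the rank.  Subadditivity is itself a counting
-- argument: k independent columns of M − N lie in the span of rank M columns
-- of M and rank N columns of N, which yields an injection of 𝔽^k into
-- 𝔽^(rank M) × 𝔽^(rank N).
module Submission where

open import Defs
open import Data.Nat using (ℕ; _≤_; _+_; _*_; _∸_; _^_; _/_)

open import Algebra.Apartness.Bundles using (HeytingField)
import Algebra.Properties.CommutativeMonoid.Sum as Sum
import Algebra.Properties.CommutativeSemigroup as CommutativeSemigroupProperties
import Algebra.Properties.Ring as RingProperties
import Algebra.Properties.Semiring.Sum as SemiringSum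
open import Data.Fin.Base as Fin using (Fin; zero; suc; toℕ)
import Data.Fin.Properties as Fin
open import Data.Nat using (zero; suc; _<_; z≤n; s≤s; nonTrivial⇒n>1)
open import Data.Nat.DivMod using (m*n/n≡m; m/n*n≤m)
open import Data.Nat.Primality using (prime⇒nonTrivial)
import Data.Nat.Properties as ℕ
open import Data.Nat.Solver using (module +-*-Solver)
open import Data.Product.Base using (Σ-syntax; ∃-syntax; _×_; _,_; proj₁; proj₂)
open import Data.Product.Function.NonDependent.Setoid using (_×-inverse_)
open import Data.Product.Relation.Binary.Pointwise.NonDependent
  using (_×ₛ_; Pointwise-≡↔≡)
open import Data.Vec.Functional using (_∷_; _++_)
import Data.Vec.Functional.Relation.Binary.Pointwise.Properties as Pointwise
open import Function.Base using (_∘_)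
open import Function.Bundles using (Inverse; Injection)
import Function.Properties.Inverse as Inv
open import Level using (Level; _⊔_)
open import Relation.Binary.Bundles using (Setoid)
open import Relation.Binary.PropositionalEquality as ≡ using (_≡_; refl)
import Relation.Binary.Reasoning.Setoid as SetoidReasoning
import Relation.Unary as U
open import Relation.Unary using (Pred)
open import Relation.Nullary.Decidable using (Dec; yes; no; decidable-stable)
open import Relation.Nullary.Negation using (¬_)

private
  variable
    a c p ℓ ℓ₁ ℓ₂ : Level

-- Bounded search and comparison of finite cardinalities.

module _ {P : Pred ℕ p} (P? : U.Decidable P) where

  greatest-satisfies : P 0 → ∀ n → P (greatest P? n)
  greatest-satisfies p₀ zero = p₀
  greatest-satisfies p₀ (suc n) with P? (suc n)
  ... | yes pₙ = pₙ
  ... | no  _  = greatest-satisfies p₀ n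

  ≤-greatest : ∀ {k} n → k ≤ n → P k → k ≤ greatest P? n
  ≤-greatest zero    k≤0 _ = k≤0
  ≤-greatest (suc n) k≤1+n pₖ with P? (suc n)
  ... | yes _  = k≤1+n
  ... | no ¬pₙ = ≤-greatest n
    (ℕ.≤-pred (ℕ.≤∧≢⇒< k≤1+n (λ { refl → ¬pₙ pₖ }))) pₖ

HasSize-× : {S : Setoid a ℓ} {T : Setoid c ℓ₁} {k m : ℕ} →
            HasSize S k → HasSize T m → HasSize (S ×ₛ T) (k * m)
HasSize-× S≅ T≅ = Inv.trans (S≅ ×-inverse T≅)
  (Inv.trans Pointwise-≡↔≡ (Inv.sym Fin.*↔×))

-- The map `f` is only evaluated at the representatives that `from` picks, so it is enough that it
-- reflects equality.
HasSize-≤ : {S : Setoid a ℓ} {T : Setoid c ℓ₁} {k m : ℕ} →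
            HasSize S k → HasSize T m →
            (f : Setoid.Carrier S → Setoid.Carrier T) →
            (∀ {x y} → Setoid._≈_ T (f x) (f y) → Setoid._≈_ S x y) → k ≤ m
HasSize-≤ S≅ T≅ f f-injective = Fin.injective⇒≤
  {f = Inverse.to T≅ ∘ f ∘ Inverse.from S≅}
  (Injection.injective (Inv.Inverse⇒Injection (Inv.sym S≅)) ∘
   f-injective ∘
   Injection.injective (Inv.Inverse⇒Injection T≅))

-- Used to turn an injection between coordinate spaces, read as an inequality between powers of `q`,
-- into an inequality of dimensions.
^-cancelʳ-≤ : ∀ m {n o} → 1 < m → m ^ n ≤ m ^ o → n ≤ o
^-cancelʳ-≤ m 1<m mⁿ≤mᵒ =
  ℕ.≮⇒≥ (λ o<n → ℕ.<⇒≱ (ℕ.^-monoʳ-< m 1<m o<n) mⁿ≤mᵒ)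

primePower>1 : ∀ {q} → IsPrimePower q → 1 < q
-- Strict monotonicity of powers applies because `1` is `p ^ 0`.
primePower>1 (p , k , p-prime , 1≤k , refl) = ℕ.^-monoʳ-< p
  (nonTrivial⇒n>1 p {{prime⇒nonTrivial p-prime}}) 1≤k

-- Triangular numbers and finite sums.

triangle : ℕ → ℕ
triangle zero    = 0
triangle (suc n) = suc n + triangle n

triangle-formula : ∀ n → triangle n ≡ n * (n + 1) / 2
triangle-formula n =
  -- The division by 2 is exact, so proving the doubled identity suffices.
  ≡.trans (≡.sym (m*n/n≡m (triangle n) 2)) (≡.cong (_/ 2) (triangle*2 n))
  where
  triangle*2 : ∀ n → triangle n * 2 ≡ n * (n + 1)
  triangle*2 zero    = refl
  triangle*2 (suc n) = begin
    (suc n + triangle n) * 2       ≡⟨ ℕ.*-distribʳ-+ 2 (suc n) (triangle n) ⟩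
    suc n * 2 + triangle n * 2     ≡⟨ ≡.cong (suc n * 2 +_) (triangle*2 n) ⟩
    suc n * 2 + n * (n + 1)        ≡⟨ solve 1 (λ x →
      (con 1 :+ x) :* con 2 :+ x :* (x :+ con 1) :=
      (con 1 :+ x) :* (con 1 :+ x :+ con 1)) refl n ⟩
    suc n * (suc n + 1)            ∎
    where
    open ≡.≡-Reasoning
    open +-*-Solver

private
  module Σℕ = Sum ℕ.+-0-commutativeMonoid

sum-mono-≤ : ∀ {n} {f g : Fin n → ℕ} → (∀ i → f i ≤ g i) → Σℕ.sum f ≤ Σℕ.sum g
sum-mono-≤ {zero}  f≤g = z≤n
sum-mono-≤ {suc n} f≤g = ℕ.+-mono-≤ (f≤g zero) (sum-mono-≤ (f≤g ∘ suc))

term≤sum : ∀ {n} (f : Fin n → ℕ) i → f i ≤ Σℕ.sum f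
term≤sum f zero    = ℕ.m≤m+n _ _
term≤sum f (suc i) = ℕ.≤-trans (term≤sum (f ∘ suc) i) (ℕ.m≤n+m _ _)

module LinearAlgebra {q : ℕ} (𝔽 : FiniteField c ℓ₁ ℓ₂ q) where

  open FlagRank 𝔽 renaming (_-_ to _-ᵁ_)
  open FiniteField 𝔽 hiding (refl; zero) renaming (_+_ to _+ᶠ_; _*_ to _*ᶠ_)
  open HeytingField heytingField using (_#_; #⇒invertible; tight)
  open SemiringSum semiring
  open RingProperties ring
    renaming ( \\-leftDividesʳ to -x+[x+y]≈y
             ; x∙y⁻¹≈ε⇒x≈y to x-y≈0⇒x≈y; x≈y⇒x∙y⁻¹≈ε to x≈y⇒x-y≈0)
  open CommutativeSemigroupProperties +-commutativeSemigroup using (interchange)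
  open SetoidReasoning setoid

  private
    variable
      k m n r : ℕ

  -- Linear combinations.

  infix 7 _∙_
  _∙_ : Vector k → (Fin k → Vector m) → Vector m
  _∙_ {k = k} x v i = ∑[ j < k ] (x j *ᶠ v j i)

  +-interchange-- : ∀ x y z w → (x - y) +ᶠ (z - w) ≈ (x +ᶠ z) - (y +ᶠ w)
  +-interchange-- x y z w =
    trans (interchange x (- y) z (- w)) (+-congˡ (-‿+-comm y w))

  ∑-distrib-- : (f g : Vector n) →
                ∑[ i < n ] (f i - g i) ≈ ∑[ i < n ] f i - ∑[ i < n ] g i
  ∑-distrib-- {zero}  f g = sym (-‿inverseʳ 0#)
  ∑-distrib-- {suc n} f g = trans (+-congˡ (∑-distrib-- (f ∘ suc) (g ∘ suc)))
                                  (+-interchange-- _ _ _ _)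

  ∙-distribˡ-- : ∀ (x : Vector k) (v w : Fin k → Vector m) i →
                 (x ∙ (λ j i → v j i - w j i)) i ≈ (x ∙ v) i - (x ∙ w) i
  ∙-distribˡ-- {k = k} x v w i =
    trans (sum-cong-≋ {n = k} (λ j → x[y-z]≈xy-xz (x j) (v j i) (w j i)))
          (∑-distrib-- {n = k} _ _)

  ∙-distribʳ-- : ∀ (x y : Vector k) (v : Fin k → Vector m) i →
                 ((λ j → x j - y j) ∙ v) i ≈ (x ∙ v) i - (y ∙ v) i
  ∙-distribʳ-- {k = k} x y v i =
    trans (sum-cong-≋ {n = k} (λ j → [y-z]x≈yx-zx (v j i) (x j) (y j)))
          (∑-distrib-- {n = k} _ _)

  -- Associativity of the matrix product, with `x` a row vector and each family read as the matrix
  -- of its rows.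
  ∙-assoc : ∀ (x : Vector k) (a : Fin k → Vector r) (w : Fin r → Vector m) i →
            ((x ∙ a) ∙ w) i ≈ (x ∙ (λ j → a j ∙ w)) i
  ∙-assoc {k = k} {r = r} x a w i = begin
    ∑[ l < r ] ((∑[ j < k ] (x j *ᶠ a j l)) *ᶠ w l i)
      ≈⟨ sum-cong-≋ {n = r} (λ l → *-distribʳ-sum {n = k} (w l i) _) ⟩
    ∑[ l < r ] (∑[ j < k ] (x j *ᶠ a j l *ᶠ w l i))
      ≈⟨ ∑-comm {m = r} {n = k} _ ⟩
    ∑[ j < k ] (∑[ l < r ] (x j *ᶠ a j l *ᶠ w l i))
      ≈⟨ sum-cong-≋ {n = k} (λ j → sum-cong-≋ {n = r} (λ l → *-assoc _ _ _)) ⟩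
    ∑[ j < k ] (∑[ l < r ] (x j *ᶠ (a j l *ᶠ w l i)))
      ≈⟨ sum-cong-≋ {n = k} (λ j → *-distribˡ-sum {n = r} (x j) _) ⟨
    ∑[ j < k ] (x j *ᶠ (∑[ l < r ] (a j l *ᶠ w l i))) ∎

  linearlyIndependent⇒injective :
    {v : Fin k → Vector m} → LinearlyIndependent v →
    {x y : Vector k} → (∀ i → (x ∙ v) i ≈ (y ∙ v) i) → ∀ j → x j ≈ y j
  linearlyIndependent⇒injective {v = v} li {x} {y} eq j = x-y≈0⇒x≈y _ _
    (li (λ j → x j - y j)
        (λ i → trans (∙-distribʳ-- x y v i) (x≈y⇒x-y≈0 (eq i))) j)

  -- Spans and coordinates.

  infix 4 _∈span_
  _∈span_ : Vector m → (Fin r → Vector m) → Set (c ⊔ ℓ₁)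
  _∈span_ {r = r} u w = Σ[ x ∈ Vector r ] (∀ i → u i ≈ (x ∙ w) i)

  -- Exhaustive search over the finitely many coefficient vectors; it later licenses proofs by
  -- contradiction about spans.
  _∈span?_ : (u : Vector m) (w : Fin r → Vector m) → Dec (u ∈span w)
  _∈span?_ {r = r} u w = any? (vector-size size r)
    (λ x → Fin.all? (λ i → u i ≈? (x ∙ w) i))
    (λ x≋y h i → trans (h i) (sum-cong-≋ (λ j → *-congʳ (x≋y j))))

  -- The length is tied to zero by an equation because it will be a rank, which is zero only
  -- propositionally.
  span-[] : {u : Vector m} {w : Fin r → Vector m} → r ≡ 0 →
            u ∈span w → ∀ i → u i ≈ 0#
  span-[] refl (_ , eq) = eq

  ∈⇒∈span : (w : Fin r → Vector m) → ∀ j → w j ∈span w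
  ∈⇒∈span {r = r} w j = e j , λ i → sym (e∙ w j i)
    where
    -- `e j` is the `j`-th standard basis vector.
    e : Fin n → Vector n
    e zero    = 1# ∷ λ _ → 0#
    e (suc j) = 0# ∷ e j
    0∙ : (w : Fin n → Vector m) → ∀ i → ((λ _ → 0#) ∙ w) i ≈ 0#
    0∙ {n = n} w i = trans (sum-cong-≋ {n = n} (λ j → zeroˡ _)) (sum-replicate-zero n)
    e∙ : (w : Fin n → Vector m) → ∀ j i → (e j ∙ w) i ≈ w j i
    e∙ w zero    i = trans (+-cong (*-identityˡ _) (0∙ (w ∘ suc) i)) (+-identityʳ _)
    e∙ w (suc j) i = trans (+-cong (zeroˡ _) (e∙ (w ∘ suc) j i)) (+-identityˡ _)

  -- Change of spanning family: expanding each `u j` over `w` turns coefficients over `u` into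
  -- coefficients over `w` of the same vector.
  coordinates : {u : Fin k → Vector m} {w : Fin r → Vector m} →
                (∀ j → u j ∈span w) → Vector k → Vector r
  coordinates u∈w x = x ∙ (proj₁ ∘ u∈w)

  coordinates-reflect : {u : Fin k → Vector m} {w : Fin r → Vector m} →
    (u∈w : ∀ j → u j ∈span w) {x y : Vector k} →
    (∀ l → coordinates u∈w x l ≈ coordinates u∈w y l) →
    ∀ i → (x ∙ u) i ≈ (y ∙ u) i
  coordinates-reflect {u = u} {w} u∈w {x} {y} eq i = begin
    (x ∙ u) i                      ≈⟨ expand x ⟩
    (coordinates u∈w x ∙ w) i      ≈⟨ sum-cong-≋ (λ l → *-congʳ (eq l)) ⟩
    (coordinates u∈w y ∙ w) i      ≈⟨ expand y ⟨
    (y ∙ u) i                      ∎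
    where
    expand : ∀ x → (x ∙ u) i ≈ (coordinates u∈w x ∙ w) i
    expand x = trans (sum-cong-≋ (λ j → *-congˡ (proj₂ (u∈w j) i)))
                     (sym (∙-assoc x (proj₁ ∘ u∈w) w i))

  -- Inverses and extension of independent families.

  inverse : ∀ {x} → ¬ (x ≈ 0#) → ∃[ y ] y *ᶠ x ≈ 1#
  -- Inequality yields apartness from zero only up to double negation. The existence of an inverse
  -- is decidable by search, so the double negation can be removed.
  inverse {x} x≉0 = decidable-stable
    (any? size (λ y → y *ᶠ x ≈? 1#) (λ y≈z h → trans (*-congʳ (sym y≈z)) h))
    (λ ¬inv → x≉0 (proj₁ (tight x 0#) (λ x#0 → ¬inv (invert x#0))))
    where
    x-0≈x : x - 0# ≈ x
    x-0≈x = trans (+-congˡ -0#≈0#) (+-identityʳ x)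
    invert : x # 0# → ∃[ y ] y *ᶠ x ≈ 1#
    invert x#0 with #⇒invertible x#0
    ... | y , yx≈1 , _ = y , trans (*-congˡ (sym x-0≈x)) yx≈1

  -- In a vanishing combination a nonzero head coefficient could be divided out, putting `v zero` in
  -- the span of the rest. So it is zero, and independence of the tail applies.
  linearlyIndependent-∷ : {v : Fin (suc k) → Vector m} →
    LinearlyIndependent (v ∘ suc) → ¬ (v zero ∈span v ∘ suc) →
    LinearlyIndependent v
  linearlyIndependent-∷ {k = k} {v = v} li v₀∉span x rel = λ where
      zero    → x₀≈0
      (suc j) → li (x ∘ suc) (λ i → trans (sym (drop-head i)) (rel i)) j
    where
    rest : Vector _
    rest = (x ∘ suc) ∙ (v ∘ suc)
    x₀≈0 : x zero ≈ 0#
    x₀≈0 = decidable-stable (x zero ≈? 0#) λ x₀≉0 →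
      let y , yx₀≈1 = inverse x₀≉0 in
      v₀∉span ((λ j → - y *ᶠ x (suc j)) , λ i → begin
        v zero i                       ≈⟨ *-identityˡ _ ⟨
        1# *ᶠ v zero i                 ≈⟨ *-congʳ yx₀≈1 ⟨
        y *ᶠ x zero *ᶠ v zero i        ≈⟨ *-assoc _ _ _ ⟩
        y *ᶠ (x zero *ᶠ v zero i)      ≈⟨ *-congˡ (+-inverseˡ-unique _ _ (rel i)) ⟩
        y *ᶠ (- rest i)                ≈⟨ -‿distribʳ-* _ _ ⟨
        - (y *ᶠ rest i)                ≈⟨ -‿distribˡ-* _ _ ⟩
        - y *ᶠ rest i                  ≈⟨ *-distribˡ-sum {n = k} (- y) _ ⟩
        ∑[ j < k ] (- y *ᶠ (x (suc j) *ᶠ v (suc j) i))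
          ≈⟨ sum-cong-≋ {n = k} (λ j → *-assoc (- y) (x (suc j)) (v (suc j) i)) ⟨
        ((λ j → - y *ᶠ x (suc j)) ∙ (v ∘ suc)) i ∎)
    drop-head : ∀ i → (x ∙ v) i ≈ rest i
    drop-head i = trans (+-congʳ (trans (*-congʳ x₀≈0) (zeroˡ _))) (+-identityˡ _)

  -- Rank and column bases.

  maximalIndependentColumns : (M : Matrix m n) → HasIndependentColumns M (rank M)
  maximalIndependentColumns {n = n} M =
    -- The empty family is independent, so the default value 0 of `greatest` is attained too.
    greatest-satisfies (hasIndependentColumns? M) ((λ ()) , λ _ _ ()) n

  module _ (1<q : 1 < q) where

    -- Coefficients over `k` independent columns inject into coefficients over all `n` columns, so
    -- `q ^ k ≤ q ^ n`. As `rank` searches only up to the width, this makes it the maximum over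
    -- families of every size.
    independentColumns≤width : (M : Matrix m n) → HasIndependentColumns M k → k ≤ n
    independentColumns≤width {n = n} {k = k} M (f , li) = ^-cancelʳ-≤ q 1<q
      (HasSize-≤ (vector-size size k) (vector-size size n)
        (coordinates columns∈span)
        (linearlyIndependent⇒injective {v = column M ∘ f} li ∘
         coordinates-reflect columns∈span))
      where
      columns∈span : ∀ j → column M (f j) ∈span column M
      columns∈span j = ∈⇒∈span (column M) (f j)

    -- A largest independent family spans: a column outside its span would extend it to an
    -- independent family with one more member.
    column-basis : (M : Matrix m n) →
      Σ[ f ∈ (Fin (rank M) → Fin n) ] (∀ j → column M j ∈span (column M ∘ f))
    column-basis {n = n} M = f , λ j → decidable-stable (column M j ∈span? (column M ∘ f))
      λ j∉span →
        let f′ : HasIndependentColumns M (suc (rank M))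
            f′ = j ∷ f , linearlyIndependent-∷ {v = column M ∘ (j ∷ f)} li j∉span
        in ℕ.<-irrefl refl (≤-greatest (hasIndependentColumns? M) n
             (independentColumns≤width M f′) f′)
      where
      f  = proj₁ (maximalIndependentColumns M)
      li = proj₂ (maximalIndependentColumns M)

    rank-subadditive : (M N : Matrix m n) →
                       rank (λ i j → M i j - N i j) ≤ rank M + rank N
    rank-subadditive {n = n} M N = ^-cancelʳ-≤ q 1<q (≡.subst (q ^ rank M-N ≤_)
      (≡.sym (ℕ.^-distribˡ-+-* q (rank M) (rank N)))
      (HasSize-≤ (vector-size size (rank M-N))
        (HasSize-× (vector-size size (rank M)) (vector-size size (rank N)))
        (λ x → coordinates M∈span x , coordinates N∈span x)
        -- Equal coordinates give equal combinations of the columns of `M` and of `N`, hence of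
        -- their difference; independence then recovers the coefficients.
        (λ (eqM , eqN) → linearlyIndependent⇒injective {v = column M-N ∘ f} li λ i →
          combine i (coordinates-reflect M∈span eqM i) (coordinates-reflect N∈span eqN i))))
      where
      M-N : Matrix _ n
      M-N i j = M i j - N i j
      f  = proj₁ (maximalIndependentColumns M-N)
      li = proj₂ (maximalIndependentColumns M-N)
      M∈span : ∀ j → column M (f j) ∈span (column M ∘ proj₁ (column-basis M))
      M∈span j = proj₂ (column-basis M) (f j)
      N∈span : ∀ j → column N (f j) ∈span (column N ∘ proj₁ (column-basis N))
      N∈span j = proj₂ (column-basis N) (f j)
      combine : ∀ {x y} i →
        (x ∙ (column M ∘ f)) i ≈ (y ∙ (column M ∘ f)) i →
        (x ∙ (column N ∘ f)) i ≈ (y ∙ (column N ∘ f)) i →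
        (x ∙ (column M-N ∘ f)) i ≈ (y ∙ (column M-N ∘ f)) i
      combine {x} {y} i eqM eqN = begin
        (x ∙ (column M-N ∘ f)) i
          ≈⟨ ∙-distribˡ-- x (column M ∘ f) (column N ∘ f) i ⟩
        (x ∙ (column M ∘ f)) i - (x ∙ (column N ∘ f)) i
          ≈⟨ +-cong eqM (-‿cong eqN) ⟩
        (y ∙ (column M ∘ f)) i - (y ∙ (column N ∘ f)) i
          ≈⟨ ∙-distribˡ-- y (column M ∘ f) (column N ∘ f) i ⟨
        (y ∙ (column M-N ∘ f)) i ∎

    rank≡0⇒zero : (M : Matrix m n) → rank M ≡ 0 → ∀ i j → M i j ≈ 0#
    rank≡0⇒zero M rank≡0 i j = span-[] rank≡0 (proj₂ (column-basis M) j) i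

    -- Flag rank and entries of upper triangular matrices.

    fr-subadditive : (A B : U n) → d-fr A B ≤ fr A + fr B
    fr-subadditive {n = n} A B = ≡.subst (d-fr A B ≤_)
      (Σℕ.∑-distrib-+ {n} _ _)
      (sum-mono-≤ {n} (λ i → rank-subadditive (proj₁ A [ i ]) (proj₁ B [ i ])))

    -- Each block has rank zero. For `i ≤ j` the entry at `i`, `j` lies in the last row of the
    -- `i`-th block, at column `j ∸ i`; the entries below the diagonal vanish already.
    fr≡0⇒zero : (A : U n) → fr A ≡ 0 → ∀ i j → proj₁ A i j ≈ 0#
    fr≡0⇒zero {n = n} (M , M-upper) fr≡0 i j with j Fin.<? i
    ... | yes j<i = M-upper i j j<i
    ... | no  j≮i = trans (reflexive (≡.sym (≡.cong₂ M row≡i column≡j)))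
                          (rank≡0⇒zero (M [ i ]) block-rank≡0 row col)
      where
      i≤j : toℕ i ≤ toℕ j
      i≤j = ℕ.≮⇒≥ j≮i
      row : Fin (suc (toℕ i))
      row = Fin.fromℕ (toℕ i)
      col : Fin (n ∸ toℕ i)
      col = Fin.fromℕ< (ℕ.∸-monoˡ-< (Fin.toℕ<n j) i≤j)
      row≡i : Fin.inject≤ row (Fin.toℕ<n i) ≡ i
      row≡i = Fin.toℕ-injective
        (≡.trans (Fin.toℕ-inject≤ row (Fin.toℕ<n i)) (Fin.toℕ-fromℕ (toℕ i)))
      column≡j : Fin.cast (ℕ.m+[n∸m]≡n (Fin.toℕ≤n i)) (toℕ i Fin.↑ʳ col) ≡ j
      column≡j = Fin.toℕ-injective (≡.trans (Fin.toℕ-cast _ (toℕ i Fin.↑ʳ col))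
        (≡.trans (Fin.toℕ-↑ʳ (toℕ i) col)
        (≡.trans (≡.cong (toℕ i +_) (Fin.toℕ-fromℕ< _)) (ℕ.m+[n∸m]≡n i≤j))))
      block-rank≡0 : rank (M [ i ]) ≡ 0
      block-rank≡0 = ℕ.n≤0⇒n≡0 (≡.subst (rank (M [ i ]) ≤_) fr≡0
        (term≤sum (λ i → rank (M [ i ])) i))

  -- Peeling off the first row together with the first column matches the recursion of `triangle`.
  -- The first column below the corner is dropped, being zero for upper triangular matrices.
  upperEntries : Matrix n n → Vector (triangle n)
  upperEntries {n = zero}  M = λ ()
  upperEntries {n = suc n} M = M zero ++ upperEntries (λ i j → M (suc i) (suc j))

  upperEntries-injective : {M N : Matrix n n} →
    IsUpperTriangular M → IsUpperTriangular N →
    (∀ l → upperEntries M l ≈ upperEntries N l) → ∀ i j → M i j ≈ N i j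
  upperEntries-injective {n = suc n} {M} {N} M-upper N-upper eq = λ where
      zero    j       → proj₁ parts j
      (suc i) zero    → trans (M-upper (suc i) zero (s≤s z≤n))
                              (sym (N-upper (suc i) zero (s≤s z≤n)))
      (suc i) (suc j) → upperEntries-injective
        (λ i j j<i → M-upper (suc i) (suc j) (s≤s j<i))
        (λ i j j<i → N-upper (suc i) (suc j) (s≤s j<i))
        (proj₂ parts) i j
    where
    parts = Pointwise.++⁻ _≈_ (M zero) (N zero) eq

  -- Sphere packing.

  telescope : ∀ x y z → (x - y) +ᶠ (y - z) ≈ x - z
  telescope x y z = trans (+-assoc x (- y) (y - z)) (+-congˡ (-x+[x+y]≈y y (- z)))

  exchange : ∀ {a b x y} → a - x ≈ b - y → a - b ≈ x - y
  -- Adding `b - x` telescopes the left side to `a - x` and the right side to `b - y`.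
  exchange {a} {b} {x} {y} eq = +-cancelʳ (b - x) _ _ (begin
    (a - b) +ᶠ (b - x) ≈⟨ telescope a b x ⟩
    a - x              ≈⟨ eq ⟩
    b - y              ≈⟨ telescope b x y ⟨
    (b - x) +ᶠ (x - y) ≈⟨ +-comm _ _ ⟩
    (x - y) +ᶠ (b - x) ∎)

  module _ (1<q : 1 < q) (C : Code n ℓ) (δ : ℕ) (C-δ : HasMinimumDistance C δ) where

    private
      t = (δ ∸ 1) / 2

    -- The minimum is attained by two distinct codewords, and at distance zero they would coincide.
    -- Positivity ensures that the truncated `δ ∸ 1` is still smaller than `δ`.
    minimumDistance>0 : 1 ≤ δ
    minimumDistance>0 with proj₁ C-δ
    ... | A , B , _ , _ , A≉B , d≡δ = ℕ.n≢0⇒n>0 λ δ≡0 → A≉B λ i j →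
      x-y≈0⇒x≈y _ _ (fr≡0⇒zero 1<q (A -ᵁ B) (≡.trans d≡δ δ≡0) i j)

    2t<δ : t + t < δ
    2t<δ = ℕ.≤-<-trans
      (≡.subst (_≤ δ ∸ 1)
        (≡.trans (ℕ.*-comm t 2) (≡.cong (t +_) (ℕ.+-identityʳ t))) (m/n*n≤m (δ ∸ 1) 2))
      (ℕ.≤-reflexive (ℕ.m+[n∸m]≡n minimumDistance>0))

    packing : ∀ {A B X Y} → A ∈ C → B ∈ C → Ball n t X → Ball n t Y →
              (∀ i j → proj₁ A i j - proj₁ X i j ≈ proj₁ B i j - proj₁ Y i j) →
              A ≈ᵁ B × X ≈ᵁ Y
    packing {A} {B} {X} {Y} A∈C B∈C X∈ball Y∈ball eq = A≈B , λ i j →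
      x-y≈0⇒x≈y _ _ (trans (sym (exchange (eq i j))) (x≈y⇒x-y≈0 (A≈B i j)))
      where
      d≤2t : d-fr A B ≤ t + t
      d≤2t = ≡.subst (_≤ t + t)
        (≡.sym (fr-cong {A = A -ᵁ B} {B = X -ᵁ Y} (λ i j → exchange (eq i j))))
        (ℕ.≤-trans (fr-subadditive 1<q X Y) (ℕ.+-mono-≤ X∈ball Y∈ball))
      A≈B : A ≈ᵁ B
      -- Equality of matrices is decidable, so it suffices to refute inequality, which would force a
      -- distance of at least `δ`.
      A≈B = decidable-stable
        (Fin.all? (λ i → Fin.all? (λ j → proj₁ A i j ≈? proj₁ B i j)))
        (λ A≉B → ℕ.<⇒≱ 2t<δ (ℕ.≤-trans (proj₂ C-δ A B A∈C B∈C A≉B) d≤2t))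

    spherePacking : ∣ C ∣ * b n t ≤ q ^ triangle n
    spherePacking = HasSize-≤
      (HasSize-× (Code.hasCard C) (proj₂ (Ball-size n t)))
      (vector-size size (triangle n))
      -- The difference is again upper triangular, hence determined by its entries on and above the
      -- diagonal.
      (λ ((A , _) , (X , _)) → upperEntries (proj₁ (A -ᵁ X)))
      (λ { {(A , A∈C) , (X , X∈ball)} {(B , B∈C) , (Y , Y∈ball)} eq →
        packing {A} {B} {X} {Y} A∈C B∈C X∈ball Y∈ball
          (upperEntries-injective (proj₂ (A -ᵁ X)) (proj₂ (B -ᵁ Y)) eq) })

theorem4p1 : ∀ {c ℓ₁ ℓ₂ ℓ} (n q : ℕ) → 1 ≤ n → IsPrimePower q →
    (𝔽 : FiniteField c ℓ₁ ℓ₂ q) → let open FlagRank 𝔽 in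
    (C : Code n ℓ) (δ : ℕ) → HasMinimumDistance C δ →
    let t = (δ ∸ 1) / 2 in
    ∣ C ∣ * b n t ≤ q ^ (n * (n + 1) / 2)
theorem4p1 n q _ q-primePower 𝔽 C δ C-δ =
  ≡.subst (λ e → FlagRank.∣_∣ C * FlagRank.b 𝔽 n ((δ ∸ 1) / 2) ≤ q ^ e)
    (triangle-formula n)
    (LinearAlgebra.spherePacking 𝔽 (primePower>1 q-primePower) C δ C-δ)
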